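{- If $G$ is a finite simple undirected graph that is $(P_6,\text{HHD})$-free and has an efficient dominating set, then its square $G^2$ is chordal.
   Context: All graphs are finite, undirected and simple. A vertex dominates itself and its neighbors. A set $D\subseteq V$ is an efficient dominating set (e.d.) of $G=(V,E)$ if every vertex of $G$ is dominated by exactly one vertex of $D$. The square $G^2=(V,E^2)$ has $uv\in E^2$ iff $d_G(u,v)\in\{1,2\}$. "$F$-free" means containing no induced subgraph isomorphic to $F$. $P_k$ (resp. $C_k$) is the chordless path (resp. cycle) on $k$ vertices. A hole is a $C_k$ with $k\ge 5$. The house is the complement of $P_5$. The domino is the graph on six vertices obtained from a $P_5$ $x_1,\ldots,x_5$ by adding a vertex $y$ adjacent exactly to $x_1,x_3,x_5$. A graph is HHD-free if it has no induced house, hole or domino; $(P_6,\text{HHD})$-free means HHD-free and $P_6$-free. A graph is chordal if it is $C_k$-free for every $k\ge 4$. -}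

module Defs where

open import Data.Empty using (⊥)
open import Data.Fin using (Fin; zero; suc; toℕ)
open import Data.Fin.Properties using (any?) renaming (_≟_ to _≟ᶠ_)
open import Data.Fin.Subset using (Subset; inside; outside; _∈_)
open import Data.Fin.Subset.Properties using (_∈?_)
open import Data.Nat using (ℕ; zero; suc; _<_; _≤_; _≟_; z<s)
open import Data.Nat.Properties using (allUpTo?)
open import Data.Product using (_×_; _,_; ∃; ∃!)
open import Data.Sum using (_⊎_; inj₁; inj₂; swap; map)
open import Data.Vec using ([]; _∷_)
open import Function.Base using (_∘_)
open import Function.Bundles using (_⇔_)
open import Function.Definitions using (Injective)
open import Level using (0ℓ)
open import Relation.Binary.Core using (Rel)
open import Relation.Binary.Definitions using (Symmetric; Irreflexive; Decidable)
open import Relation.Binary.PropositionalEquality using (_≡_; _≢_; refl; sym; ≢-sym)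
open import Relation.Nullary using (¬_; Dec; no; ¬?)
open import Relation.Nullary.Decidable using (_×-dec_; _⊎-dec_; map′)

-- A finite simple undirected graph with vertex set Fin n.  Decidability of
-- adjacency holds classically for every graph and is recorded as data here.
record Graph (n : ℕ) : Set₁ where
  field
    Adj    : Rel (Fin n) 0ℓ
    symm   : Symmetric Adj
    irrefl : Irreflexive _≡_ Adj
    adj?   : Decidable Adj

open Graph public

fromRel : ∀ {n} {R : Rel (Fin n) 0ℓ} → Decidable R → Graph n
fromRel {R = R} R? = record
  { Adj    = λ i j → i ≢ j × (R i j ⊎ R j i)
  ; symm   = λ (i≢j , r) → ≢-sym i≢j , swap r
  ; irrefl = λ i≡j (i≢j , _) → i≢j i≡j
  ; adj?   = λ i j → ¬? (i ≟ᶠ j) ×-dec (R? i j ⊎-dec R? j i)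
  }

complement : ∀ {n} → Graph n → Graph n
complement G = record
  { Adj    = λ i j → i ≢ j × ¬ Adj G i j
  ; symm   = λ (i≢j , ¬a) → ≢-sym i≢j , ¬a ∘ symm G
  ; irrefl = λ i≡j (i≢j , _) → i≢j i≡j
  ; adj?   = λ i j → ¬? (i ≟ᶠ j) ×-dec ¬? (adj? G i j)
  }

-- The new vertex is zero; it is adjacent to exactly the members of S.
addVertex : ∀ {n} → Graph n → Subset n → Graph (suc n)
addVertex {n} G S = record
  { Adj    = A
  ; symm   = λ {i} {j} → s i j
  ; irrefl = λ { {i} refl → ir i }
  ; adj?   = d
  }
  where
  A : Rel (Fin (suc n)) 0ℓ
  A zero    zero    = ⊥
  A zero    (suc j) = j ∈ S
  A (suc i) zero    = i ∈ S
  A (suc i) (suc j) = Adj G i j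

  s : ∀ i j → A i j → A j i
  s zero    (suc j) a = a
  s (suc i) zero    a = a
  s (suc i) (suc j) a = symm G a

  ir : ∀ i → ¬ A i i
  ir (suc i) a = irrefl G refl a

  d : Decidable A
  d zero    zero    = no λ ()
  d zero    (suc j) = j ∈? S
  d (suc i) zero    = i ∈? S
  d (suc i) (suc j) = adj? G i j

P : ∀ k → Graph k
P k = fromRel {R = λ i j → suc (toℕ i) ≡ toℕ j} λ i j → suc (toℕ i) ≟ toℕ j

-- Only meaningful for k ≥ 3; for smaller k this degenerates to P k.
C : ∀ k → Graph k
C k = fromRel {R = λ i j → suc (toℕ i) ≡ toℕ j ⊎ (suc (toℕ i) ≡ k × toℕ j ≡ 0)}
  λ i j → (suc (toℕ i) ≟ toℕ j) ⊎-dec ((suc (toℕ i) ≟ k) ×-dec (toℕ j ≟ 0))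

house : Graph 5
house = complement (P 5)

domino : Graph 6
domino = addVertex (P 5) (inside ∷ outside ∷ inside ∷ outside ∷ inside ∷ [])

-- f is an isomorphism from H onto the subgraph of G induced by the image of f.
record IsInducedEmbedding {k n} (H : Graph k) (G : Graph n)
                          (f : Fin k → Fin n) : Set where
  field
    injective : Injective _≡_ _≡_ f
    adj⇔adj   : ∀ i j → Adj H i j ⇔ Adj G (f i) (f j)

infix 4 _-Free_

_-Free_ : ∀ {k n} → Graph k → Graph n → Set
H -Free G = ¬ ∃ (IsInducedEmbedding H G)

HoleFree : ∀ {n} → Graph n → Set
HoleFree G = ∀ k → 5 ≤ k → C k -Free G

HHD-Free : ∀ {n} → Graph n → Set
HHD-Free G = house -Free G × HoleFree G × domino -Free G

Chordal : ∀ {n} → Graph n → Set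
Chordal G = ∀ k → 4 ≤ k → C k -Free G

module _ {n} (G : Graph n) where

  Dominates : Rel (Fin n) 0ℓ
  Dominates u v = u ≡ v ⊎ Adj G u v

  EfficientDominating : Subset n → Set
  EfficientDominating D = ∀ v → ∃! _≡_ λ d → d ∈ D × Dominates d v

  data Walk : ℕ → Rel (Fin n) 0ℓ where
    []  : ∀ {u} → Walk 0 u u
    _∷_ : ∀ {k u v w} → Adj G u v → Walk k v w → Walk (suc k) u w

  -- d_G(u,v) = k, as a relation since the distance between vertices in
  -- different components is infinite.
  Distance : Fin n → Fin n → ℕ → Set
  Distance u v k = Walk k u v × (∀ {j} → j < k → ¬ Walk j u v)

  walk? : ∀ k → Decidable (Walk k)
  walk? zero    u v = map′ (λ { refl → [] }) (λ { [] → refl }) (u ≟ᶠ v)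
  walk? (suc k) u w = map′ (λ (_ , a , p) → a ∷ p) (λ { (a ∷ p) → _ , a , p })
    (any? λ v → adj? G u v ×-dec walk? k v w)

  distance? : ∀ u v k → Dec (Distance u v k)
  distance? u v k = walk? k u v ×-dec allUpTo? (λ j → ¬? (walk? j u v)) k

  snoc : ∀ {k u v w} → Walk k u v → Adj G v w → Walk (suc k) u w
  snoc []      b = b ∷ []
  snoc (a ∷ p) b = a ∷ snoc p b

  reverse : ∀ {k u v} → Walk k u v → Walk k v u
  reverse []      = []
  reverse (a ∷ p) = snoc (reverse p) (symm G a)

  distance-sym : ∀ {u v k} → Distance u v k → Distance v u k
  distance-sym (p , min) = reverse p , λ j<k q → min j<k (reverse q)

  square : Graph n
  square = record
    { Adj    = λ u v → Distance u v 1 ⊎ Distance u v 2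
    ; symm   = map distance-sym distance-sym
    ; irrefl = λ { refl (inj₁ (_ , min)) → min z<s []
                 ; refl (inj₂ (_ , min)) → min z<s [] }
    ; adj?   = λ u v → distance? u v 1 ⊎-dec distance? u v 2
    }

{-# OPTIONS --safe #-}
module Submission where

-- Let v₀ … vₖ₋₁ be an induced cycle of G², k ≥ 4. In an HHD-free graph, two neighbours a, b of u
-- are adjacent as soon as a path avoiding N[u] joins them whose first vertex after b misses a
-- ("bypass"). Hence no vᵢvᵢ₊₁ is an edge of G, and for common neighbours xᵢ of vᵢ and vᵢ₊₁ the
-- cycle x₀ … xₖ₋₁ lies in G and each of its chords spans a triangle on either side; in particular
-- some xᵢ and xᵢ₊₂ are adjacent. Write δ w for the vertex of D dominating w. Whenever xy joins a
-- neighbour x of p to a neighbour y of q and δ p, δ q are distinct from each other and from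
-- δ x, δ y, the path δ p, p, x, y, q, δ q is a P₆. This excludes xᵢ ∈ D, makes the δ vᵢ distinct,
-- and, applied around the chord xᵢxᵢ₊₂, gives the final contradiction.

open import Data.Bool using (Bool; true; false)
open import Data.Bool.Properties using () renaming (_≟_ to _≟ᵇ_)
open import Data.Empty using (⊥; ⊥-elim)
open import Data.Fin using (Fin; zero; suc; toℕ) renaming (_<_ to _<ᶠ_)
open import Data.Fin.Properties using (all?; any?; toℕ-injective; toℕ<n; toℕ-fromℕ<)
  renaming (_≟_ to _≟ᶠ_; <-cmp to <ᶠ-cmp)
open import Data.Fin.Subset using (Subset; _∈_)
open import Data.Fin.Subset.Properties using (_∈?_)
open import Data.Nat using (ℕ; zero; suc; _+_; _*_; _∸_; _≤_; _<_; _≤′_; ≤′-refl; ≤′-step;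
  z≤n; s≤s; z<s; s<s; s≤s⁻¹; _≟_)
open import Data.Nat.DivMod using (_/_; _%_; _mod_; m≡m%n+[m/n]*n; [m+n]%n≡m%n;
  [m+kn]%n≡m%n; m%n%n≡m%n; m<n⇒m%n≡m; n%n≡0; m%n<n)
open import Data.Nat.Properties
open import Data.Product using (∃; ∃₂; _×_; _,_; proj₁; proj₂)
open import Data.Sum using (_⊎_; inj₁; inj₂)
open import Data.Unit using (⊤; tt)
open import Data.Vec using (Vec; lookup; []; _∷_)
open import Function.Base using (_∘_)
open import Function.Bundles using (_⇔_; mk⇔; Equivalence)
open import Relation.Binary.Definitions using (tri<; tri≈; tri>)
open import Relation.Binary.PropositionalEquality
open import Relation.Nullary using (¬_; Dec; yes; no; does; ¬?)
open import Relation.Nullary.Decidable using (_×-dec_; _⊎-dec_; True; toWitness; does-⇔)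
open import Relation.Unary using (Pred; Decidable)
open import Level using (0ℓ)
open import Defs

open Equivalence using (to; from)

-- Induced copies of small fixed graphs

AllFin : ∀ k → (Fin k → Set) → Set
AllFin zero    Q = ⊤
AllFin (suc k) Q = Q zero × AllFin k (Q ∘ suc)

AllPairs : ∀ k → (Fin k → Fin k → Set) → Set
AllPairs zero    R = ⊤
AllPairs (suc k) R = AllFin k (R zero ∘ suc) × AllPairs k (λ i j → R (suc i) (suc j))

allFin : ∀ {k} {Q : Fin k → Set} → AllFin k Q → ∀ i → Q i
allFin (q , _)  zero    = q
allFin (_ , qs) (suc i) = allFin qs i

allPairs : ∀ {k} {R : Fin k → Fin k → Set} → AllPairs k R → ∀ {i j} → i <ᶠ j → R i j
allPairs (r , _)  {zero}  {suc j} _         = allFin r j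
allPairs (_ , rs) {suc i} {suc j} (s≤s i<j) = allPairs rs i<j

-- For a concrete graph this computes to the bare edge or non-edge, so `AllPairs` unfolds to a
-- nested tuple of such facts.
Agrees : Bool → Set → Set
Agrees true  B = B
Agrees false B = ¬ B

agrees⇒⇔ : ∀ {A B : Set} (a? : Dec A) → Agrees (does a?) B → A ⇔ B
agrees⇒⇔ (yes a) b  = mk⇔ (λ _ → b) (λ _ → a)
agrees⇒⇔ (no ¬a) ¬b = mk⇔ (⊥-elim ∘ ¬a) (⊥-elim ∘ ¬b)

-- When no two vertices share a neighbourhood, a map preserving and reflecting adjacency is
-- automatically injective. For a concrete `H` the condition is settled by evaluation.
TwinFree : ∀ {k} → Graph k → Set
TwinFree H = ∀ i j → i ≡ j ⊎ ∃ λ w → does (adj? H i w) ≢ does (adj? H j w)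

twinFree? : ∀ {k} (H : Graph k) → Dec (TwinFree H)
twinFree? H = all? λ i → all? λ j →
  (i ≟ᶠ j) ⊎-dec any? λ w → ¬? (does (adj? H i w) ≟ᵇ does (adj? H j w))

module _ {n} (G : Graph n) where

  private
    V : Set
    V = Fin n

    infix 4 _~_

    _~_ : V → V → Set
    _~_ = Adj G

    ~-sym : ∀ {a b} → a ~ b → b ~ a
    ~-sym = symm G

    ~-irrefl : ∀ {a} → ¬ a ~ a
    ~-irrefl = irrefl G refl

    _~?_ : ∀ a b → Dec (a ~ b)
    _~?_ = adj? G

  adj⇔-from-< : ∀ {k} (H : Graph k) (f : Fin k → V) →
    (∀ {i j} → i <ᶠ j → Adj H i j ⇔ f i ~ f j) → ∀ i j → Adj H i j ⇔ f i ~ f j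
  adj⇔-from-< H f hyp i j with <ᶠ-cmp i j
  ... | tri< i<j _ _  = hyp i<j
  ... | tri≈ _ refl _ = mk⇔ (⊥-elim ∘ irrefl H refl) (⊥-elim ∘ ~-irrefl)
  ... | tri> _ _ j<i  = mk⇔ (~-sym ∘ to (hyp j<i) ∘ symm H) (symm H ∘ from (hyp j<i) ∘ ~-sym)

  embedding-from-pairs : ∀ {k} (H : Graph k) → True (twinFree? H) → (xs : Vec V k) →
    AllPairs k (λ i j → Agrees (does (adj? H i j)) (lookup xs i ~ lookup xs j)) →
    ∃ (IsInducedEmbedding H G)
  embedding-from-pairs H tf xs pairs = lookup xs , record
    { injective = λ {i} {j} → inj i j
    ; adj⇔adj   = adj⇔
    }
    where
    adj⇔ : ∀ i j → Adj H i j ⇔ lookup xs i ~ lookup xs j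
    adj⇔ = adj⇔-from-< H (lookup xs) λ {i} {j} i<j → agrees⇒⇔ (adj? H i j) (allPairs pairs i<j)

    inj : ∀ i j → lookup xs i ≡ lookup xs j → i ≡ j
    inj i j eq with toWitness {a? = twinFree? H} tf i j
    ... | inj₁ i≡j       = i≡j
    ... | inj₂ (w , i≢j) = ⊥-elim (i≢j (does-⇔
      (mk⇔ (λ a → from (adj⇔ j w) (subst (_~ lookup xs w) eq (to (adj⇔ i w) a)))
           (λ a → from (adj⇔ i w) (subst (_~ lookup xs w) (sym eq) (to (adj⇔ j w) a))))
      (adj? H i w) (adj? H j w)))

  P₆-free⇒⊥ : P 6 -Free G → ∀ {a b c d e f} →
    a ~ b → b ~ c → c ~ d → d ~ e → e ~ f →
    ¬ a ~ c → ¬ a ~ d → ¬ a ~ e → ¬ a ~ f → ¬ b ~ d → ¬ b ~ e → ¬ b ~ f →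
    ¬ c ~ e → ¬ c ~ f → ¬ d ~ f → ⊥
  P₆-free⇒⊥ free {a} {b} {c} {d} {e} {f} ab bc cd de ef ac ad ae af bd be bf ce cf df =
    free (embedding-from-pairs (P 6) tt (a ∷ b ∷ c ∷ d ∷ e ∷ f ∷ [])
      ( (ab , ac , ad , ae , af , tt) , (bc , bd , be , bf , tt)
      , (cd , ce , cf , tt) , (de , df , tt) , (ef , tt) , tt , tt))

  house-free⇒⊥ : house -Free G → ∀ {u a q b z} →
    u ~ a → a ~ q → q ~ b → b ~ u → ¬ u ~ q → ¬ a ~ b →
    z ~ q → z ~ b → ¬ z ~ u → ¬ z ~ a → ⊥
  house-free⇒⊥ free {u} {a} {q} {b} {z} ua aq qb bu uq ab zq zb zu za =
    -- The square `u`, `a`, `q`, `b` with roof `z` on the edge `qb` is the complement of the path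
    -- `b`, `a`, `z`, `u`, `q`.
    free (embedding-from-pairs house tt (b ∷ a ∷ z ∷ u ∷ q ∷ [])
      ( (ab ∘ ~-sym , ~-sym zb , bu , ~-sym qb , tt) , (za ∘ ~-sym , ~-sym ua , aq , tt)
      , (zu , zq , tt) , (uq , tt) , tt , tt))

  domino-free⇒⊥ : domino -Free G → ∀ {u a q b y r} →
    u ~ a → a ~ q → q ~ b → b ~ u → q ~ y → y ~ r → r ~ b →
    ¬ u ~ q → ¬ a ~ b → ¬ q ~ r → ¬ b ~ y → ¬ u ~ y → ¬ u ~ r → ¬ a ~ y → ¬ a ~ r → ⊥
  domino-free⇒⊥ free {u} {a} {q} {b} {y} {r} ua aq qb bu qy yr rb uq ab qr by uy ur ay ar =
    -- The underlying `P 5` is `u`, `a`, `q`, `y`, `r`, and `b` is the vertex added to it.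
    free (embedding-from-pairs domino tt (b ∷ u ∷ a ∷ q ∷ y ∷ r ∷ [])
      ( (bu , ab ∘ ~-sym , ~-sym qb , by , ~-sym rb , tt) , (ua , uq , uy , ur , tt)
      , (aq , ay , ar , tt) , (qy , qr , tt) , (yr , tt) , tt , tt))

  -- Paths inside a set of vertices, and induced paths

  data Path (T : Pred V 0ℓ) : V → V → Set where
    [_]   : ∀ {s} → T s → Path T s s
    _∷⟨_⟩_ : ∀ {s r t} → T s → s ~ r → Path T r t → Path T s t

  infixr 5 _∷⟨_⟩_

  Path-map : ∀ {T U : Pred V 0ℓ} → (∀ {y} → T y → U y) → ∀ {s t} → Path T s t → Path U s t
  Path-map h [ Ts ]         = [ h Ts ]
  Path-map h (Ts ∷⟨ a ⟩ p) = h Ts ∷⟨ a ⟩ Path-map h p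

  Path-head : ∀ {T s t} → Path T s t → T s
  Path-head [ Ts ]         = Ts
  Path-head (Ts ∷⟨ _ ⟩ _) = Ts

  Path-snoc : ∀ {T s r t} → Path T s r → r ~ t → T t → Path T s t
  Path-snoc [ Ts ]         b Tt = Ts ∷⟨ b ⟩ [ Tt ]
  Path-snoc (Ts ∷⟨ a ⟩ p) b Tt = Ts ∷⟨ a ⟩ Path-snoc p b Tt

  Path-reverse : ∀ {T s t} → Path T s t → Path T t s
  Path-reverse [ Ts ]         = [ Ts ]
  Path-reverse (Ts ∷⟨ a ⟩ p) = Path-snoc (Path-reverse p) (~-sym a) Ts

  firstHit : ∀ {T Q : Pred V 0ℓ} → Decidable Q → ∀ {s t} → Path T s t → Q t →
    Q s ⊎ ∃₂ λ r q → Path (λ y → T y × ¬ Q y) s r × r ~ q × T q × Q q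
  firstHit Q? [ Ts ] Qt = inj₁ Qt
  firstHit Q? {s} (Ts ∷⟨ a ⟩ p) Qt with Q? s | firstHit Q? p Qt
  ... | yes Qs | _                              = inj₁ Qs
  ... | no ¬Qs | inj₁ Qr                        = inj₂ (_ , _ , [ Ts , ¬Qs ] , a , Path-head p , Qr)
  ... | no ¬Qs | inj₂ (_ , _ , p′ , b , Tq , Qq) =
    inj₂ (_ , _ , (Ts , ¬Qs) ∷⟨ a ⟩ p′ , b , Tq , Qq)

  -- Values of `g` beyond `m` are arbitrary; indexing by all of ℕ makes a suffix a mere shift.
  record InducedPath (m : ℕ) (g : ℕ → V) : Set where
    field
      step : ∀ {i} → i < m → g i ~ g (suc i)
      far  : ∀ {i j} → suc i < j → j ≤ m → g i ≢ g j × ¬ g i ~ g j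

    distinct : ∀ {i j} → i < j → j ≤ m → g i ≢ g j
    distinct i<j j≤m eq with m≤n⇒m<n∨m≡n i<j
    ... | inj₁ 1+i<j = proj₁ (far 1+i<j j≤m) eq
    ... | inj₂ refl  = irrefl G eq (step j≤m)

  open InducedPath

  suffix : ∀ {g} r l → InducedPath (r + l) g → InducedPath r (λ i → g (i + l))
  suffix r l ind = record
    { step = λ i<r → step ind (+-monoˡ-< l i<r)
    ; far  = λ i<j j≤r → far ind (+-monoˡ-< l i<j) (+-monoˡ-≤ l j≤r)
    }

  lastIndex : ∀ {Q : Pred ℕ 0ℓ} → Decidable Q → ∀ {a b} → a ≤′ b → Q a →
    ∃ λ c → a ≤ c × c ≤ b × Q c × (∀ {j} → c < j → j ≤ b → ¬ Q j)
  lastIndex Q? {a} ≤′-refl Qa = a , ≤-refl , ≤-refl , Qa , λ a<j j≤a → ⊥-elim (<⇒≱ a<j j≤a)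
  lastIndex Q? {b = suc b} (≤′-step a≤b) Qa with Q? (suc b) | lastIndex Q? a≤b Qa
  ... | yes Qb | _ =
    suc b , m≤n⇒m≤1+n (≤′⇒≤ a≤b) , ≤-refl , Qb , λ b<j j≤b → ⊥-elim (<⇒≱ b<j j≤b)
  ... | no ¬Qb | c , a≤c , c≤b , Qc , above = c , a≤c , m≤n⇒m≤1+n c≤b , Qc , above′
    where
    above′ : ∀ {j} → c < j → j ≤ suc b → ¬ _
    above′ c<j j≤1+b with m≤n⇒m<n∨m≡n j≤1+b
    ... | inj₁ j<1+b = above c<j (s≤s⁻¹ j<1+b)
    ... | inj₂ refl  = ¬Qb

  -- Prepending s to an induced path: jump directly to the last vertex in the closed
  -- neighbourhood of s.
  toInduced : ∀ {T s t} → Path T s t → ∃₂ λ m g →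
    g 0 ≡ s × g m ≡ t × (∀ {i} → i ≤ m → T (g i)) × InducedPath m g
  toInduced {s = s} [ Ts ] = 0 , (λ _ → s) , refl , refl , (λ _ → Ts) , record
    { step = λ ()
    ; far  = λ i<j j≤0 → ⊥-elim (n≮0 (<-≤-trans i<j j≤0))
    }
  toInduced {T} {s} (Ts ∷⟨ a ⟩ p) with toInduced p
  ... | m , g , refl , refl , Tg , ind
    with lastIndex (λ i → (s ≟ᶠ g i) ⊎-dec (s ~? g i)) (≤⇒≤′ (z≤n {m})) (inj₂ a)
  ... | l , _ , l≤m , closest , above with m ∸ l | m∸n+n≡m l≤m | closest
  ... | r | refl | inj₁ refl = r , (λ i → g (i + l)) , refl , refl
      , (λ i≤r → Tg (+-monoˡ-≤ l i≤r)) , suffix r l ind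
  ... | r | refl | inj₂ s~gl = suc r , h , refl , refl , Th , record { step = st ; far = fa }
    where
    h : ℕ → V
    h zero    = s
    h (suc i) = g (i + l)

    Th : ∀ {i} → i ≤ suc r → T (h i)
    Th {zero}  _         = Ts
    Th {suc i} (s≤s i≤r) = Tg (+-monoˡ-≤ l i≤r)

    st : ∀ {i} → i < suc r → h i ~ h (suc i)
    st {zero}  _         = s~gl
    st {suc i} (s≤s i<r) = step ind (+-monoˡ-< l i<r)

    fa : ∀ {i j} → suc i < j → j ≤ suc r → h i ≢ h j × ¬ h i ~ h j
    fa {zero}  {suc j} (s≤s 0<j) (s≤s j≤r) = out ∘ inj₁ , out ∘ inj₂
      where
      out : ¬ (s ≡ g (j + l) ⊎ s ~ g (j + l))
      out = above (+-monoˡ-≤ l 0<j) (+-monoˡ-≤ l j≤r)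
    fa {suc i} {suc j} (s≤s i<j) (s≤s j≤r) = far ind (+-monoˡ-< l i<j) (+-monoˡ-≤ l j≤r)

  -- Hole-freeness and the bypass

  inducedCycle⇒⊥ : HoleFree G → ∀ {m g u} → 3 ≤ m → InducedPath m g → u ~ g 0 → u ~ g m →
    (∀ {i} → 0 < i → i < m → u ≢ g i × ¬ u ~ g i) → ⊥
  -- Prefixing `u` to `g 0`, ..., `g m` gives a cycle on `2 + m` vertices, which is a hole because
  -- `3 ≤ m`.
  inducedCycle⇒⊥ holeFree {m} {g} {u} 3≤m ind u~g₀ u~gₘ inner = holeFree (2 + m) (s≤s (s≤s 3≤m))
    (f , record { injective = inj _ _ ; adj⇔adj = adj⇔-from-< (C (2 + m)) f pairs })
    where
    h : ℕ → V
    h zero    = u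
    h (suc i) = g i

    f : Fin (2 + m) → V
    f = h ∘ toℕ

    -- Meant for `i < j`: the closing pair is `0`, `suc m`, which `C` lists in the opposite order.
    CycAdj : ℕ → ℕ → Set
    CycAdj i j = suc i ≡ j ⊎ (i ≡ 0 × j ≡ suc m)

    h-adj : ∀ {i j} → CycAdj i j → j ≤ suc m → h i ~ h j
    h-adj {zero}  (inj₁ refl)          _         = u~g₀
    h-adj {suc i} (inj₁ refl)          (s≤s i<m) = step ind i<m
    h-adj         (inj₂ (refl , refl)) _         = u~gₘ

    h-nonadj : ∀ {i j} → i < j → j ≤ suc m → ¬ CycAdj i j → h i ≢ h j × ¬ h i ~ h j
    h-nonadj {zero} {suc j} _ (s≤s j≤m) ¬c =
      inner (n≢0⇒n>0 λ { refl → ¬c (inj₁ refl) }) (≤∧≢⇒< j≤m λ { refl → ¬c (inj₂ (refl , refl)) })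
    h-nonadj {suc i} {suc j} (s≤s i<j) (s≤s j≤m) ¬c =
      far ind (≤∧≢⇒< i<j λ { refl → ¬c (inj₁ refl) }) j≤m

    cycAdj? : ∀ i j → Dec (CycAdj i j)
    cycAdj? i j = (suc i ≟ j) ⊎-dec ((i ≟ 0) ×-dec (j ≟ suc m))

    bound : ∀ (j : Fin (2 + m)) → toℕ j ≤ suc m
    bound j = s≤s⁻¹ (toℕ<n j)

    C⇔CycAdj : ∀ {i j} → i <ᶠ j → Adj (C (2 + m)) i j ⇔ CycAdj (toℕ i) (toℕ j)
    C⇔CycAdj {i} {j} i<j = mk⇔
      (λ { (_ , inj₁ (inj₁ eq))       → inj₁ eq
         ; (_ , inj₁ (inj₂ (_ , eq))) → ⊥-elim (n≮0 (subst (toℕ i <_) eq i<j))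
         ; (_ , inj₂ (inj₁ eq))       → ⊥-elim (<⇒≱ i<j (≤-trans (n≤1+n _) (≤-reflexive eq)))
         ; (_ , inj₂ (inj₂ (eq , z))) → inj₂ (z , suc-injective eq) })
      (λ { (inj₁ eq)       → i≢j , inj₁ (inj₁ eq)
         ; (inj₂ (z , eq)) → i≢j , inj₂ (inj₂ (cong suc eq , z)) })
      where
      i≢j : i ≢ j
      i≢j refl = <-irrefl refl i<j

    pairs : ∀ {i j} → i <ᶠ j → Adj (C (2 + m)) i j ⇔ f i ~ f j
    pairs {i} {j} i<j with cycAdj? (toℕ i) (toℕ j)
    ... | yes c = mk⇔ (λ _ → h-adj c (bound j)) (λ _ → from (C⇔CycAdj i<j) c)
    ... | no ¬c = mk⇔ (⊥-elim ∘ ¬c ∘ to (C⇔CycAdj i<j))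
                      (⊥-elim ∘ proj₂ (h-nonadj i<j (bound j) ¬c))

    apart : ∀ {i j} → i <ᶠ j → f i ≢ f j
    apart {i} {j} i<j eq with cycAdj? (toℕ i) (toℕ j)
    ... | yes c = irrefl G eq (h-adj c (bound j))
    ... | no ¬c = proj₁ (h-nonadj i<j (bound j) ¬c) eq

    inj : ∀ i j → f i ≡ f j → i ≡ j
    inj i j eq with <ᶠ-cmp i j
    ... | tri< i<j _ _ = ⊥-elim (apart i<j eq)
    ... | tri≈ _ i≡j _ = i≡j
    ... | tri> _ _ j<i = ⊥-elim (apart j<i (sym eq))

  Avoids : V → Pred V 0ℓ
  Avoids u y = u ≢ y × ¬ u ~ y

  -- Shorten the path from `s` to `t` to an induced one. With `u` it closes an induced cycle, so a
  -- single inner vertex remains, and it lies in `T`.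
  holeFree⇒commonNeighbour : HoleFree G → ∀ {T u s t z z′} → (∀ {y} → T y → Avoids u y) →
    u ~ s → u ~ t → s ≢ t → ¬ s ~ t → s ~ z → Path T z z′ → z′ ~ t →
    ∃ λ y → T y × s ~ y × y ~ t
  holeFree⇒commonNeighbour holeFree {T} {u} {s} {t} avoids u~s u~t s≢t s≁t s~z p z′~t
    with toInduced {T = λ y → (y ≡ s ⊎ y ≡ t) ⊎ T y}
           (inj₁ (inj₁ refl) ∷⟨ s~z ⟩ Path-snoc (Path-map inj₂ p) z′~t (inj₁ (inj₂ refl)))
  ... | m , g , refl , refl , Tg , ind = go m refl
    where
    inside : ∀ {i} → 0 < i → i < m → T (g i)
    inside 0<i i<m with Tg (<⇒≤ i<m)
    ... | inj₁ (inj₁ eq) = ⊥-elim (distinct ind 0<i (<⇒≤ i<m) (sym eq))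
    ... | inj₁ (inj₂ eq) = ⊥-elim (distinct ind i<m ≤-refl eq)
    ... | inj₂ Ty        = Ty

    go : ∀ m′ → m′ ≡ m → ∃ λ y → T y × g 0 ~ y × y ~ g m
    go 0 refl = ⊥-elim (s≢t refl)
    go 1 refl = ⊥-elim (s≁t (step ind z<s))
    go 2 refl = g 1 , inside z<s (s<s z<s) , step ind z<s , step ind (s<s z<s)
    go (suc (suc (suc m′))) refl = ⊥-elim (inducedCycle⇒⊥ holeFree (s≤s (s≤s (s≤s z≤n))) ind u~s u~t
      λ 0<i i<m → avoids (inside 0<i i<m))

  -- The first neighbour q of a on the path closes a C₄ with u, a, b; the part of the path
  -- between b and q then yields a triangle or a C₄ on the edge bq, hence a house or a domino.
  bypass : HHD-Free G → ∀ {u a b z z′} → u ~ a → u ~ b → b ~ z → ¬ a ~ z →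
    Path (Avoids u) z z′ → a ~ z′ → a ~ b
  bypass (houseFree , holeFree , dominoFree) {u} {a} {b} {z} u~a u~b b~z a≁z p a~z′
    with a ~? b | firstHit (a ~?_) p a~z′
  ... | yes a~b | _ = a~b
  ... | no _    | inj₁ a~z = ⊥-elim (a≁z a~z)
  ... | no a≁b  | inj₂ (r₁ , q , p₁ , r₁~q , Tq , a~q) = ⊥-elim absurd
    where
    Aside : Pred V 0ℓ
    Aside y = Avoids u y × ¬ a ~ y

    b~q : b ~ q
    -- Before `q` the path has no neighbour of `a`, so the common neighbour of `b` and `a` found
    -- here must be `q`.
    b~q with holeFree⇒commonNeighbour holeFree {T = λ y → Avoids u y × (¬ a ~ y ⊎ y ≡ q)}
               proj₁ u~b u~a (λ { refl → a≁z b~z }) (a≁b ∘ ~-sym) b~z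
               (Path-snoc (Path-map (λ (t , c) → t , inj₁ c) p₁) r₁~q (Tq , inj₂ refl)) (~-sym a~q)
    ... | y , (_ , inj₁ a≁y)  , b~y , y~a = ⊥-elim (a≁y (~-sym y~a))
    ... | y , (_ , inj₂ refl) , b~y , y~a = b~y

    no-triangle : ∀ {y} → Aside y → b ~ y → y ~ q → ⊥
    no-triangle ((_ , u≁y) , a≁y) b~y y~q = house-free⇒⊥ houseFree u~a a~q (~-sym b~q) (~-sym u~b)
      (proj₂ Tq) a≁b y~q (~-sym b~y) (u≁y ∘ ~-sym) (a≁y ∘ ~-sym)

    absurd : ⊥
    absurd with firstHit (b ~?_) (Path-reverse p₁) b~z
    ... | inj₁ b~r₁ = no-triangle (Path-head (Path-reverse p₁)) b~r₁ r₁~q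
    ... | inj₂ (r₂ , r , p₂ , r₂~r , Ar@((_ , u≁r) , a≁r) , b~r) with r ~? q
    ... | yes r~q = no-triangle Ar b~r r~q
    -- Now `b` is the apex: the segment from `r` to `q` has no inner neighbour of `b`, so it
    -- shortens to one vertex `y`, giving a second square `b`, `r`, `y`, `q`.
    ... | no r≁q with holeFree⇒commonNeighbour holeFree
                        {T = λ y → Aside y × ¬ b ~ y}
                        (λ (((_ , u≁y) , _) , b≁y) → (λ { refl → u≁y u~b }) , b≁y)
                        b~r b~q (λ { refl → a≁r a~q }) r≁q (~-sym r₂~r)
                        (Path-reverse p₂) r₁~q
    ... | y , (((_ , u≁y) , a≁y) , b≁y) , r~y , y~q = domino-free⇒⊥ dominoFree
      u~a a~q (~-sym b~q) (~-sym u~b) (~-sym y~q) (~-sym r~y) (~-sym b~r)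
      (proj₂ Tq) a≁b (r≁q ∘ ~-sym) b≁y u≁y u≁r a≁y a≁r

  -- Induced cycles of the square

  Close : V → V → Set
  Close p q = p ~ q ⊎ ∃ λ m → p ~ m × m ~ q

  -- An induced C (4 + e) in the square, unrolled to a periodic sequence; the cyclic predecessor
  -- of index a is 3 + e + a.
  record SquareCycle (e : ℕ) (v : ℕ → V) : Set where
    field
      period   : ∀ a → v (4 + e + a) ≡ v a
      injective : ∀ {a b} → a < b → b < 4 + e + a → v a ≢ v b
      near     : ∀ a → Close (v a) (v (suc a))
      farApart      : ∀ {a b} → suc a < b → suc b < 4 + e + a → ¬ Close (v a) (v b)

  module _ (hhd : HHD-Free G) {e v} (cycle : SquareCycle e v) where

    open SquareCycle cycle

    private
      -- Consecutive vertices are joined by an edge or through a middle vertex chosen by `near`;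
      -- `Tm` must therefore cover every possible middle vertex.
      walk : ∀ {T : Pred V 0ℓ} {c s} → c ≤′ s → (∀ {o} → c ≤ o → o ≤ s → T (v o)) →
        (∀ {o m} → c ≤ o → o < s → v o ~ m → m ~ v (suc o) → T m) → Path T (v c) (v s)
      walk ≤′-refl Tv _ = [ Tv ≤-refl ≤-refl ]
      walk {s = suc s} (≤′-step c≤s) Tv Tm
        with walk c≤s (λ c≤o o≤s → Tv c≤o (m≤n⇒m≤1+n o≤s)) (λ c≤o o<s → Tm c≤o (m<n⇒m<1+n o<s))
           | near s
      ... | p | inj₁ a           = Path-snoc p a (Tv (m≤n⇒m≤1+n (≤′⇒≤ c≤s)) ≤-refl)
      ... | p | inj₂ (m , a , b) = Path-snoc (Path-snoc p a (Tm (≤′⇒≤ c≤s) ≤-refl a b)) b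
                                     (Tv (m≤n⇒m≤1+n (≤′⇒≤ c≤s)) ≤-refl)

    -- Given such an edge, `v (suc a)` reaches `v (2 + a)` only through some `b`. The rest of the
    -- cycle leads from `v (2 + a)` back to `v a` outside the closed neighbourhood of `v (suc a)`,
    -- so `bypass` gives `v a ~ b` and brings `v a` close to `v (2 + a)`.
    consecutive-nonadjacent : ∀ a → ¬ v a ~ v (suc a)
    consecutive-nonadjacent a va~va₁ with near (suc a)
    ... | inj₁ va₁~va₂ =
      farApart ≤-refl (s≤s (s≤s (s≤s (s≤s (m≤n+m a e))))) (inj₂ (_ , va~va₁ , va₁~va₂))
    ... | inj₂ (b , va₁~b , b~va₂) = va≁b (detour (near (3 + e + a)))
      where
      va≁va₂ : ¬ Close (v a) (v (2 + a))
      va≁va₂ = farApart ≤-refl (s≤s (s≤s (s≤s (s≤s (m≤n+m a e)))))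

      va≁b : ¬ v a ~ b
      va≁b va~b = va≁va₂ (inj₂ (b , va~b , b~va₂))

      T : Pred V 0ℓ
      T = Avoids (v (suc a))

      bound : ∀ {o} → o ≤ 3 + e + a → suc o < 4 + e + suc a
      bound o≤ = s≤s (s≤s (≤-trans o≤ (≤-reflexive (sym (+-suc (2 + e) a)))))

      Tv : ∀ {o} → 2 + a ≤ o → o ≤ 3 + e + a → T (v o)
      Tv 2+a≤o o≤ with m≤n⇒m<n∨m≡n 2+a≤o
      ... | inj₁ 2+a<o = injective 2+a≤o (<⇒≤ (bound o≤)) , farApart 2+a<o (bound o≤) ∘ inj₁
      ... | inj₂ refl  = injective 2+a≤o (<⇒≤ (bound o≤)) , λ adj → va≁va₂ (inj₂ (_ , va~va₁ , adj))

      Tm : ∀ {o m} → 2 + a ≤ o → o ≤ 3 + e + a → v o ~ m → m ~ v (suc o) → T m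
      Tm {o} {m} 2+a≤o o≤ vo~m m~vo₁ = (λ { refl → proj₂ (Tv 2+a≤o o≤) (~-sym vo~m) }) , apart
        where
        apart : ¬ v (suc a) ~ m
        apart va₁~m with m≤n⇒m<n∨m≡n 2+a≤o
        ... | inj₁ 2+a<o = farApart 2+a<o (bound o≤) (inj₂ (m , va₁~m , ~-sym vo~m))
        -- Closeness of `v (suc a)` to `v (2 + a)` is no contradiction, so the other end `v (3 + a)`
        -- of `m` is used.
        ... | inj₂ refl  =
          farApart (n<1+n _) (bound (s≤s (s≤s (s≤s (m≤n+m a e))))) (inj₂ (m , va₁~m , m~vo₁))

      2+a≤k-1 : 2 + a ≤ 3 + e + a
      2+a≤k-1 = s≤s (s≤s (m≤n+m a (1 + e)))

      p : Path T (v (2 + a)) (v (3 + e + a))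
      p = walk (≤⇒≤′ 2+a≤k-1) Tv λ 2+a≤o o< → Tm 2+a≤o (<⇒≤ o<)

      close : ∀ {z} → Path T (v (2 + a)) z → v a ~ z → v a ~ b
      close p′ = bypass hhd (~-sym va~va₁) va₁~b b~va₂ (va≁va₂ ∘ inj₁) p′

      detour : Close (v (3 + e + a)) (v (4 + e + a)) → v a ~ b
      detour (inj₁ adj)           = close p (~-sym (subst (v (3 + e + a) ~_) (period a) adj))
      detour (inj₂ (m , adj , b)) =
        close (Path-snoc p adj (Tm 2+a≤k-1 ≤-refl adj b)) (~-sym (subst (m ~_) (period a) b))

    nonadjacent : ∀ {a b} → a < b → b < 4 + e + a → ¬ v a ~ v b
    nonadjacent {a} {b} a<b b<k+a adj with m≤n⇒m<n∨m≡n a<b | m≤n⇒m<n∨m≡n b<k+a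
    ... | inj₂ refl | _          = consecutive-nonadjacent a adj
    ... | inj₁ a₁<b | inj₁ b₁<k+a = farApart a₁<b b₁<k+a (inj₁ adj)
    ... | inj₁ _    | inj₂ refl  =
      consecutive-nonadjacent b (subst (v b ~_) (sym (period a)) (~-sym adj))

  -- Efficient domination and induced six-vertex paths

  module _ (hhd : HHD-Free G) (p6 : P 6 -Free G) {D : Subset n}
           (efficient : EfficientDominating G D) where

    private
      δ : V → V
      δ w = proj₁ (efficient w)

      δ∈D : ∀ w → δ w ∈ D
      δ∈D w = proj₁ (proj₁ (proj₂ (efficient w)))

      δ-dominates : ∀ w → Dominates G (δ w) w
      δ-dominates w = proj₂ (proj₁ (proj₂ (efficient w)))

      δ-unique : ∀ {d w} → d ∈ D → Dominates G d w → δ w ≡ d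
      δ-unique {w = w} d∈D dom = proj₂ (proj₂ (efficient w)) (d∈D , dom)

      δ-nonadjacent : ∀ {p w} → δ p ≢ δ w → ¬ δ p ~ w
      δ-nonadjacent δp≢δw adj = δp≢δw (sym (δ-unique (δ∈D _) (inj₂ adj)))

      -- Were `p` its own dominator, it would also dominate its neighbour `w`.
      δ-adjacent : ∀ {p w} → p ~ w → δ p ≢ δ w → δ p ~ p
      δ-adjacent {p} p~w δp≢δw with δ-dominates p
      ... | inj₁ eq  = ⊥-elim (δ-nonadjacent δp≢δw (subst (_~ _) (sym eq) p~w))
      ... | inj₂ adj = adj

      δ-independent : ∀ {p q} → δ p ≢ δ q → ¬ δ p ~ δ q
      δ-independent δp≢δq adj =
        δp≢δq (trans (sym (δ-unique (δ∈D _) (inj₂ adj))) (δ-unique (δ∈D _) (inj₁ refl)))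

    -- The vertices `p`, `x`, `y`, `q` form an induced path by assumption; every non-edge at `δ p`
    -- or `δ q` comes from an inequality of dominators. `x` and `y` may share a dominator.
    P₆-from-dominators : ∀ {p q x y} → ¬ p ~ q → p ~ x → x ~ y → y ~ q → ¬ x ~ q → ¬ y ~ p →
      δ p ≢ δ q → δ p ≢ δ x → δ p ≢ δ y → δ q ≢ δ x → δ q ≢ δ y → ⊥
    P₆-from-dominators p≁q p~x x~y y~q x≁q y≁p δp≢δq δp≢δx δp≢δy δq≢δx δq≢δy = P₆-free⇒⊥ p6
      (δ-adjacent p~x δp≢δx) p~x x~y y~q (~-sym (δ-adjacent (~-sym y~q) δq≢δy))
      (δ-nonadjacent δp≢δx) (δ-nonadjacent δp≢δy) (δ-nonadjacent δp≢δq) (δ-independent δp≢δq)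
      (y≁p ∘ ~-sym) p≁q (δ-nonadjacent (δp≢δq ∘ sym) ∘ ~-sym)
      x≁q (δ-nonadjacent δq≢δx ∘ ~-sym) (δ-nonadjacent δq≢δy ∘ ~-sym)

    private
      dominatingNeighbour? : ∀ p q → Dec (∃ λ m → m ∈ D × p ~ m × m ~ q)
      dominatingNeighbour? p q = any? λ m → (m ∈? D) ×-dec (p ~? m) ×-dec (m ~? q)

      commonNeighbour? : ∀ p q → Dec (∃ λ m → p ~ m × m ~ q)
      commonNeighbour? p q = any? λ m → (p ~? m) ×-dec (m ~? q)

    -- Junk value p when p and q have no common neighbour.
    commonNeighbour : V → V → V
    commonNeighbour p q with dominatingNeighbour? p q | commonNeighbour? p q
    ... | yes (m , _) | _           = m
    ... | no _        | yes (m , _) = m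
    ... | no _        | no _        = p

    commonNeighbour-adjacent : ∀ {p q} → ∃ (λ m → p ~ m × m ~ q) →
      p ~ commonNeighbour p q × commonNeighbour p q ~ q
    commonNeighbour-adjacent {p} {q} common with dominatingNeighbour? p q | commonNeighbour? p q
    ... | yes (_ , _ , adj) | _             = adj
    ... | no _              | yes (_ , adj) = adj
    ... | no _              | no none       = ⊥-elim (none common)

    -- The choice looks in `D` first. This is what lets a dominator shared by consecutive cycle
    -- vertices put some `x a` into `D`.
    commonNeighbour∈D : ∀ {p q d} → d ∈ D → p ~ d → d ~ q → commonNeighbour p q ∈ D
    commonNeighbour∈D {p} {q} d∈D p~d d~q with dominatingNeighbour? p q | commonNeighbour? p q
    ... | yes (_ , m∈D , _) | _ = m∈D
    ... | no none           | _ = ⊥-elim (none (_ , d∈D , p~d , d~q))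

    -- The cycle of common neighbours and its chords

    module _ {e v} (cycle : SquareCycle e v) where

      open SquareCycle cycle

      private
        -- Depends only on the two ends, not on the witness in `near a`, so `x` inherits the period
        -- of `v`.
        x : ℕ → V
        x a = commonNeighbour (v a) (v (suc a))

        v≁v : ∀ {a b} → a < b → b < 4 + e + a → ¬ v a ~ v b
        v≁v = nonadjacent hhd cycle

        v~x×x~v : ∀ a → v a ~ x a × x a ~ v (suc a)
        v~x×x~v a with near a
        ... | inj₁ adj    = ⊥-elim (consecutive-nonadjacent hhd cycle a adj)
        ... | inj₂ common = commonNeighbour-adjacent common

        v~x : ∀ a → v a ~ x a
        v~x = proj₁ ∘ v~x×x~v

        x~v : ∀ a → x a ~ v (suc a)
        x~v = proj₂ ∘ v~x×x~v

        x-period : ∀ a → x (4 + e + a) ≡ x a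
        x-period a = cong₂ commonNeighbour (period a)
          (trans (cong v (sym (+-suc (4 + e) a))) (period (suc a)))

        x∈D : ∀ {a d} → d ∈ D → v a ~ d → d ~ v (suc a) → x a ∈ D
        x∈D = commonNeighbour∈D

        xₚ~v : ∀ a → x (3 + e + a) ~ v a
        xₚ~v a = subst (x (3 + e + a) ~_) (period a) (x~v (3 + e + a))

        -- An edge would make `v b` close to both `v a` and `v (suc a)`, but it is cyclically next
        -- to at most one of them.
        x≁v : ∀ {a b} → suc a < b → b < 4 + e + a → ¬ x a ~ v b
        x≁v {a} {b} 1+a<b b<k+a adj with m≤n⇒m<n∨m≡n b<k+a
        ... | inj₁ 1+b<k+a = farApart 1+a<b 1+b<k+a (inj₂ (x a , v~x a , adj))
        ... | inj₂ refl    = farApart (s≤s (s≤s (s≤s (m≤n+m a e))))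
          (s≤s (≤-reflexive (sym (+-suc (3 + e) a)))) (inj₂ (x a , ~-sym (x~v a) , adj))

        v≁x : ∀ {a b} → a < b → b < 3 + e + a → ¬ v a ~ x b
        v≁x {a} {b} a<b b<K+a adj = x≁v (s≤s b<K+a) (+-monoʳ-< (4 + e) a<b)
          (subst (x b ~_) (sym (period a)) (~-sym adj))

        x≢v : ∀ {a b} → a < b → b < 4 + e + a → x a ≢ v b
        x≢v {a} a<b b<k+a eq = v≁v a<b b<k+a (subst (v a ~_) eq (v~x a))

        v≢x : ∀ {a b} → a < b → b < 4 + e + a → v a ≢ x b
        v≢x {b = b} a<b b<k+a eq = v≁v a<b b<k+a (subst (_~ v b) (sym eq) (~-sym (v~x b)))

        arc : ∀ {T : Pred V 0ℓ} {c s} → c ≤′ s → (∀ {o} → c ≤ o → o ≤ s → T (v o) × T (x o)) →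
          Path T (x c) (x s)
        arc ≤′-refl T-vx = [ proj₂ (T-vx ≤-refl ≤-refl) ]
        arc {s = suc s} (≤′-step c≤s) T-vx =
          Path-snoc (Path-snoc (arc c≤s λ c≤o o≤s → T-vx c≤o (m≤n⇒m≤1+n o≤s)) (x~v s) Tv)
                    (v~x (suc s)) Tx
          where
          Tv×Tx = T-vx (m≤n⇒m≤1+n (≤′⇒≤ c≤s)) ≤-refl
          Tv = proj₁ Tv×Tx
          Tx = proj₂ Tv×Tx

        -- The range stops before `3 + e + j` because `x (3 + e + j)` is a neighbour of `v j`.
        avoids-v : ∀ {j o} → suc j ≤ o → o < 3 + e + j → Avoids (v j) (v o) × Avoids (v j) (x o)
        avoids-v j<o o<K+j = (injective j<o o<k+j , v≁v j<o o<k+j) , (v≢x j<o o<k+j , v≁x j<o o<K+j)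
          where o<k+j = m<n⇒m<1+n o<K+j

        avoids-vₚ : ∀ j → Avoids (v j) (v (3 + e + j))
        avoids-vₚ j = injective j<k-1 ≤-refl , v≁v j<k-1 ≤-refl
          where j<k-1 = s≤s (m≤n+m j (2 + e))

      -- Both are neighbours of `v j`, and the rest of the cycle joins them outside its closed
      -- neighbourhood, so `bypass` applies.
      xₚ~x : ∀ j → x (3 + e + j) ~ x j
      xₚ~x j = bypass hhd (~-sym (xₚ~v j)) (v~x j) (x~v j)
        (v≁x (s≤s (s≤s (m≤n+m j (suc e)))) (≤-reflexive (sym (+-suc (3 + e) j))) ∘ ~-sym)
        (Path-snoc
          (proj₁ (avoids-v ≤-refl (s≤s (s≤s (m≤n+m j (suc e))))) ∷⟨ v~x (suc j) ⟩
           arc (≤⇒≤′ (s≤s (m≤n+m j (suc e)))) (λ j<o o≤ → avoids-v j<o (s≤s o≤)))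
          (x~v (2 + e + j)) (avoids-vₚ j))
        (~-sym (v~x (3 + e + j)))

      x~x : ∀ j → x j ~ x (suc j)
      x~x j = subst (_~ x (suc j)) (trans (cong x (+-suc (3 + e) j)) (x-period j)) (xₚ~x (suc j))

      -- Let `x c` be the last neighbour of `x a` before `x b`; `x (suc a)` is a candidate. The arc
      -- between `x c` and `x b` then avoids `x a` and its neighbours, and `bypass` joins them.
      chord⇒triangle : ∀ {a b} → 2 + a ≤ b → b < 4 + e + a → x a ~ x b →
        ∃ λ c → a < c × c < b × x a ~ x c × x c ~ x b
      chord⇒triangle {a} {suc b} (s≤s a<b) b₁<k+a xa~xb₁
        with lastIndex (λ c → x a ~? x c) (≤⇒≤′ a<b) (x~x a)
      ... | c , a<c , c≤b , xa~xc , above with m≤n⇒m<n∨m≡n c≤b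
      ... | inj₂ refl = c , a<c , ≤-refl , xa~xc , x~x c
      ... | inj₁ c<b  = c , a<c , s≤s c≤b , xa~xc , ~-sym (bypass hhd xa~xb₁ xa~xc (x~v c)
        (v≁x (s≤s c<b) b₁<k+c ∘ ~-sym)
        (proj₁ (avoids-x ≤-refl c<b) ∷⟨ v~x (suc c) ⟩ arc (≤⇒≤′ c<b) avoids-x)
        (~-sym (x~x b)))
        where
        b₁<k+c : suc b < 3 + e + suc c
        b₁<k+c = <-≤-trans b₁<k+a (≤-trans (≤-reflexive (sym (+-suc (3 + e) a)))
                                           (+-monoʳ-≤ (3 + e) (s≤s (<⇒≤ a<c))))

        avoids-x : ∀ {o} → suc c ≤ o → o ≤ b → Avoids (x a) (v o) × Avoids (x a) (x o)
        avoids-x {o} c<o o≤b =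
          (x≢v a<o o<k+a , x≁v 1+a<o o<k+a) ,
          -- `x o` sees `v o` while `x a` does not, so the two differ.
          ((λ eq → x≁v 1+a<o o<k+a (subst (_~ v o) (sym eq) (~-sym (v~x o)))) , above c<o o≤b)
          where
          1+a<o : suc a < o
          1+a<o = <-≤-trans (s≤s a<c) c<o
          a<o : a < o
          a<o = <-trans (n<1+n a) 1+a<o
          o<k+a : o < 4 + e + a
          o<k+a = ≤-<-trans o≤b (<-trans (n<1+n b) b₁<k+a)

      -- Induction on a bound `m` for the length `b - a`: a triangle on the chord yields a shorter
      -- chord unless both its other sides are edges of the cycle, and then `b` is `2 + a`.
      ear-within : ∀ m {a b} → 2 + a ≤ b → b ≤ m + a → b < 4 + e + a → x a ~ x b →
        ∃ λ i → x i ~ x (2 + i)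
      ear-within zero 2+a≤b b≤a _ _ = ⊥-elim (<⇒≱ (<-trans (n<1+n _) 2+a≤b) b≤a)
      ear-within (suc m) {a} {b} 2+a≤b b≤ b<k+a xa~xb with chord⇒triangle 2+a≤b b<k+a xa~xb
      ... | c , a<c , c<b , xa~xc , xc~xb with m≤n⇒m<n∨m≡n a<c | m≤n⇒m<n∨m≡n c<b
      ... | inj₁ 2+a≤c | _          = ear-within m 2+a≤c (s≤s⁻¹ (≤-trans c<b b≤))
        (<-trans c<b b<k+a) xa~xc
      ... | inj₂ refl  | inj₁ 2+c≤b = ear-within m 2+c≤b (≤-trans b≤ (≤-reflexive (sym (+-suc m a))))
        (<-≤-trans b<k+a (+-monoʳ-≤ (4 + e) (n≤1+n a))) xc~xb
      ... | inj₂ refl  | inj₂ refl  = a , xa~xb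

      ear : ∃ λ i → x i ~ x (2 + i)
      -- The closing edge of the cycle, seen from its long side, is the initial chord.
      ear = ear-within (3 + e) {0} (s≤s (s≤s z≤n)) ≤-refl ≤-refl (~-sym (xₚ~x 0))

      -- Dominators along the cycle

      shared-dominator : ∀ {a b} → a < b → b < 4 + e + a → δ (v a) ≡ δ (v b) → x a ∈ D ⊎ x b ∈ D
      shared-dominator {a} {b} a<b b<k+a eq
        with δ-dominates (v a) | subst (λ d → Dominates G d (v b)) (sym eq) (δ-dominates (v b))
      ... | inj₁ d≡va | inj₁ d≡vb = ⊥-elim (injective a<b b<k+a (trans (sym d≡va) d≡vb))
      ... | inj₁ d≡va | inj₂ d~vb = ⊥-elim (v≁v a<b b<k+a (subst (_~ v b) d≡va d~vb))
      ... | inj₂ d~va | inj₁ d≡vb = ⊥-elim (v≁v a<b b<k+a (~-sym (subst (_~ v a) d≡vb d~va)))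
      -- Only a common neighbour in `D` is left, so `a` and `b` are cyclically consecutive and the
      -- chosen `x` between them lies in `D`.
      ... | inj₂ d~va | inj₂ d~vb with m≤n⇒m<n∨m≡n a<b | m≤n⇒m<n∨m≡n b<k+a
      ... | inj₂ refl  | _           = inj₁ (x∈D (δ∈D (v a)) (~-sym d~va) d~vb)
      ... | inj₁ 1+a<b | inj₁ 1+b<k+a = ⊥-elim (farApart 1+a<b 1+b<k+a (inj₂ (_ , ~-sym d~va , d~vb)))
      ... | inj₁ _     | inj₂ refl   =
        inj₂ (x∈D (δ∈D (v a)) (~-sym d~vb) (subst (δ (v a) ~_) (sym (period a)) d~va))

      -- Otherwise `x i` dominates itself and both its neighbours on the cycle, but neither
      -- `v (2 + i)` nor `v (3 + e + i)`. These two have distinct dominators and yield a `P 6`.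
      x∉D : ∀ i → ¬ x i ∈ D
      x∉D i xᵢ∈D = absurd
        where
        k-1 : ℕ
        k-1 = 3 + e + i

        2+i<k-1 : 2 + i < k-1
        2+i<k-1 = s≤s (s≤s (s≤s (m≤n+m i e)))

        δx₁ : δ (x (1 + i)) ≡ x i
        δx₁ = δ-unique xᵢ∈D (inj₂ (x~x i))

        δxₚ : δ (x k-1) ≡ x i
        δxₚ = δ-unique xᵢ∈D (inj₂ (~-sym (xₚ~x i)))

        δxᵢ : δ (x i) ≡ x i
        δxᵢ = δ-unique xᵢ∈D (inj₁ refl)

        δv≢xᵢ : ∀ {b} → 1 + i < b → b < 4 + e + i → δ (v b) ≢ x i
        δv≢xᵢ {b} 1+i<b b<k+i eq with δ-dominates (v b)
        ... | inj₁ δ≡v = x≢v (<-trans (n<1+n i) 1+i<b) b<k+i (trans (sym eq) δ≡v)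
        ... | inj₂ δ~v = x≁v 1+i<b b<k+i (subst (_~ v b) eq δ~v)

        δv₂≢xᵢ : δ (v (2 + i)) ≢ x i
        δv₂≢xᵢ = δv≢xᵢ ≤-refl (<-trans 2+i<k-1 ≤-refl)

        δvₚ≢xᵢ : δ (v k-1) ≢ x i
        δvₚ≢xᵢ = δv≢xᵢ (<-trans ≤-refl 2+i<k-1) ≤-refl

        k-1< : ∀ c → k-1 < 4 + e + (c + i)
        k-1< c = s≤s (+-monoʳ-≤ (3 + e) (m≤n+m i c))

        δv₂≢δvₚ : δ (v (2 + i)) ≢ δ (v k-1)
        δv₂≢δvₚ eq with shared-dominator 2+i<k-1 (k-1< 2) eq
        -- `x (2 + i)` in `D` would dominate `x (1 + i)` and so equal `x i`, which misses
        -- `v (3 + i)`.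
        ... | inj₁ x₂∈D = x≁v (n≤1+n (2 + i)) (s≤s 2+i<k-1)
          (subst (_~ v (3 + i)) (trans (sym (δ-unique x₂∈D (inj₂ (~-sym (x~x (1 + i)))))) δx₁)
                 (x~v (2 + i)))
        ... | inj₂ xₚ∈D = irrefl G (trans (sym (δ-unique xₚ∈D (inj₁ refl))) δxₚ) (xₚ~x i)

        v₂~x₁ : v (2 + i) ~ x (1 + i)
        v₂~x₁ = ~-sym (x~v (1 + i))

        v₂≁vₚ : ¬ v (2 + i) ~ v k-1
        v₂≁vₚ = v≁v 2+i<k-1 (k-1< 2)

        x₁≁vₚ : ¬ x (1 + i) ~ v k-1
        x₁≁vₚ = x≁v 2+i<k-1 (k-1< 1)

        v₂≁xₚ : ¬ v (2 + i) ~ x k-1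
        v₂≁xₚ = v≁x 2+i<k-1 (+-monoʳ-< (3 + e) (n≤1+n (1 + i)))

        δv₂≢ : ∀ {w} → δ w ≡ x i → δ (v (2 + i)) ≢ δ w
        δv₂≢ δw eq = δv₂≢xᵢ (trans eq δw)

        δvₚ≢ : ∀ {w} → δ w ≡ x i → δ (v k-1) ≢ δ w
        δvₚ≢ δw eq = δvₚ≢xᵢ (trans eq δw)

        absurd : ⊥
        absurd with x (1 + i) ~? x k-1
        ... | yes x₁~xₚ = P₆-from-dominators v₂≁vₚ v₂~x₁ x₁~xₚ (~-sym (v~x k-1)) x₁≁vₚ (v₂≁xₚ ∘ ~-sym)
          δv₂≢δvₚ (δv₂≢ δx₁) (δv₂≢ δxₚ) (δvₚ≢ δx₁) (δvₚ≢ δxₚ)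
        -- Without the shortcut the path runs through `x i` and ends at `v k-1`.
        ... | no x₁≁xₚ = P₆-free⇒⊥ p6
          (δ-adjacent v₂~x₁ (δv₂≢ δx₁)) v₂~x₁ (~-sym (x~x i)) (~-sym (xₚ~x i)) (~-sym (v~x k-1))
          (δ-nonadjacent (δv₂≢ δx₁)) (δ-nonadjacent (δv₂≢ δxᵢ)) (δ-nonadjacent (δv₂≢ δxₚ))
          (δ-nonadjacent δv₂≢δvₚ)
          (x≁v ≤-refl (<-trans 2+i<k-1 ≤-refl) ∘ ~-sym) v₂≁xₚ v₂≁vₚ
          x₁≁xₚ x₁≁vₚ (x≁v (<-trans ≤-refl 2+i<k-1) ≤-refl)

      dominators-distinct : ∀ {a b} → a < b → b < 4 + e + a → δ (v a) ≢ δ (v b)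
      dominators-distinct {a} {b} a<b b<k+a eq with shared-dominator a<b b<k+a eq
      ... | inj₁ xa∈D = x∉D a xa∈D
      ... | inj₂ xb∈D = x∉D b xb∈D

      -- If `δ (v j)` dominated both, the dominators of the two cyclic neighbours of `v j` would be
      -- free to end a `P 6` through the edge between the two `x`.
      not-both : ∀ j → δ (v j) ≡ δ (x j) → δ (v j) ≢ δ (x (3 + e + j))
      not-both j eq eqₚ = P₆-from-dominators
        (v≁v 1+j<k-1 (s≤s k-1≤)) (~-sym (x~v j)) (~-sym (xₚ~x j)) (~-sym (v~x (3 + e + j)))
        (x≁v 1+j<k-1 ≤-refl) (v≁x 1+j<k-1 (+-monoʳ-< (3 + e) ≤-refl) ∘ ~-sym)
        (dominators-distinct 1+j<k-1 (s≤s k-1≤))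
        (λ eq₁ → next (trans eq (sym eq₁))) (λ eq₁ → next (trans eqₚ (sym eq₁)))
        (λ eq₁ → previous (trans eq (sym eq₁))) (λ eq₁ → previous (trans eqₚ (sym eq₁)))
        where
        1+j<k-1 : 1 + j < 3 + e + j
        1+j<k-1 = s≤s (s≤s (m≤n+m j (1 + e)))
        k-1≤ : 3 + e + j ≤ 3 + e + (1 + j)
        k-1≤ = +-monoʳ-≤ (3 + e) (n≤1+n j)
        next : δ (v j) ≢ δ (v (1 + j))
        next = dominators-distinct ≤-refl (s≤s (s≤s (m≤n+m j (2 + e))))
        previous : δ (v j) ≢ δ (v (3 + e + j))
        previous = dominators-distinct (<-trans ≤-refl 1+j<k-1) ≤-refl

      -- By `not-both`, `δ (v j)` misses one of the two `x` next to `v j`. If it also saw `x a`, the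
      -- arc from that side to `x a` would let `bypass` join it to the missed one.
      dominator-private : ∀ {j a} → j < a → a < 3 + e + j → δ (v j) ≢ δ (x a)
      dominator-private {j} {a} j<a a<k-1 eq with δ (v j) ≟ᶠ δ (x j)
        | subst (λ d → Dominates G d (x a)) (sym eq) (δ-dominates (x a))
      ... | _        | inj₁ d≡xa = x∉D a (subst (_∈ D) d≡xa (δ∈D (v j)))
      ... | no ≢xj   | inj₂ d~xa = δ-nonadjacent ≢xj
        (bypass hhd (~-sym (δ-adjacent (v~x j) ≢xj)) (v~x j) (x~v j)
          (δ-nonadjacent (dominators-distinct ≤-refl (s≤s (s≤s (m≤n+m j (2 + e))))))
          (proj₁ (avoids-v ≤-refl (≤-<-trans j<a a<k-1)) ∷⟨ v~x (suc j) ⟩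
           arc (≤⇒≤′ j<a) λ j<o o≤a → avoids-v j<o (≤-<-trans o≤a a<k-1))
          d~xa)
      -- The mirror image: the arc is followed backwards from the cyclic predecessor of `v j` to
      -- `x a`.
      ... | yes ≡xj  | inj₂ d~xa = δ-nonadjacent ≢xₚ
        (bypass hhd (~-sym (δ-adjacent (~-sym (xₚ~v j)) ≢xₚ)) (~-sym (xₚ~v j)) (~-sym (v~x (3 + e + j)))
          (δ-nonadjacent (dominators-distinct (s≤s (m≤n+m j (2 + e))) ≤-refl))
          (Path-reverse (Path-snoc
            (arc (≤⇒≤′ (s≤s⁻¹ a<k-1)) λ a≤o o≤ → avoids-v (≤-trans j<a a≤o) (s≤s o≤))
            (x~v (2 + e + j)) (avoids-vₚ j)))
          d~xa)
        where
        ≢xₚ : δ (v j) ≢ δ (x (3 + e + j))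
        ≢xₚ = not-both j ≡xj


      -- Relative to the ear at `i`, `cⱼ` stands for the dominator of `v (j + i)` and `yⱼ` for that
      -- of `x (j + i)`. Each case below is a `P 6` whose ends have dominators differing from those
      -- of the two inner vertices.
      no-squareCycle : ⊥
      no-squareCycle with ear
      ... | i , x₀~x₂ = absurd
        where
        i≤ : ∀ m c → i ≤ m + (c + i)
        i≤ m c = ≤-trans (m≤n+m i c) (m≤n+m (c + i) m)

        +e≤ : ∀ c → c + (e + i) ≤ e + (c + i)
        +e≤ c = ≤-reflexive
          (trans (sym (+-assoc c e i)) (trans (cong (_+ i) (+-comm c e)) (+-assoc e c i)))

        c₁≢y₂ : δ (v (1 + i)) ≢ δ (x (2 + i))
        c₁≢y₂ = dominator-private ≤-refl (s≤s (s≤s (s≤s (i≤ e 1))))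

        c₃≢y₀ : δ (v (3 + i)) ≢ δ (x i)
        -- `dominator-private` only looks forward, so `x i` is read one period later.
        c₃≢y₀ eq = dominator-private (s≤s (s≤s (s≤s (s≤s (m≤n+m i e)))))
          (s≤s (s≤s (s≤s (≤-trans (+e≤ 2) (+-monoʳ-≤ e (n≤1+n _))))))
          (trans eq (cong δ (sym (x-period i))))

        c₀≢y₂ : δ (v i) ≢ δ (x (2 + i))
        c₀≢y₂ = dominator-private (n≤1+n _) (s≤s (s≤s (s≤s (m≤n+m i e))))

        c₂≢y₀ : δ (v (2 + i)) ≢ δ (x i)
        c₂≢y₀ eq = dominator-private (s≤s (s≤s (s≤s (i≤ (1 + e) 0)))) (s≤s (s≤s (s≤s (+e≤ 2))))
          (trans eq (cong δ (sym (x-period i))))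

        c₀≢c₁ : δ (v i) ≢ δ (v (1 + i))
        c₀≢c₁ = dominators-distinct ≤-refl (s≤s (s≤s (i≤ (2 + e) 0)))

        c₂≢c₃ : δ (v (2 + i)) ≢ δ (v (3 + i))
        c₂≢c₃ = dominators-distinct ≤-refl (s≤s (s≤s (s≤s (s≤s (i≤ e 2)))))

        c₁∨c₃ : δ (v (1 + i)) ≢ δ (x i) → δ (v (3 + i)) ≢ δ (x (2 + i)) → ⊥
        c₁∨c₃ c₁≢y₀ c₃≢y₂ = P₆-from-dominators
          (v≁v 1<3 3<) (~-sym (x~v i)) x₀~x₂ (x~v (2 + i))
          (x≁v 1<3 (s≤s (s≤s (s≤s (s≤s (m≤n+m i e))))))
          (v≁x ≤-refl (s≤s (s≤s (s≤s (i≤ e 1)))) ∘ ~-sym)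
          (dominators-distinct 1<3 3<) c₁≢y₀ c₁≢y₂ c₃≢y₀ c₃≢y₂
          where
          1<3 : 1 + i < 3 + i
          1<3 = n≤1+n _
          3< : 3 + i < 4 + e + (1 + i)
          3< = s≤s (s≤s (s≤s (s≤s (i≤ e 1))))

        c₀∨c₂ : δ (v i) ≢ δ (x i) → δ (v (2 + i)) ≢ δ (x (2 + i)) → ⊥
        c₀∨c₂ c₀≢y₀ c₂≢y₂ = P₆-from-dominators
          (v≁v 0<2 2<) (v~x i) x₀~x₂ (~-sym (v~x (2 + i)))
          (x≁v ≤-refl 2<) (v≁x 0<2 (s≤s (s≤s (s≤s (m≤n+m i e)))) ∘ ~-sym)
          (dominators-distinct 0<2 2<) c₀≢y₀ c₀≢y₂ c₂≢y₀ c₂≢y₂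
          where
          0<2 : i < 2 + i
          0<2 = n≤1+n _
          2< : 2 + i < 4 + e + i
          2< = s≤s (s≤s (s≤s (i≤ (1 + e) 0)))

        -- x₀ is dominated by v₁'s dominator and x₂ by v₂'s, which frees v₀ and v₃.
        inner : δ (v (1 + i)) ≡ δ (x i) → δ (v (2 + i)) ≡ δ (x (2 + i)) → ⊥
        inner c₁≡y₀ c₂≡y₂ = P₆-from-dominators
          (v≁v 0<3 3<) (v~x i) x₀~x₂ (x~v (2 + i))
          (x≁v (n≤1+n _) 3<) (v≁x (n≤1+n _) (s≤s (s≤s (s≤s (m≤n+m i e)))) ∘ ~-sym)
          (dominators-distinct 0<3 3<)
          (λ eq → c₀≢c₁ (trans eq (sym c₁≡y₀))) c₀≢y₂ c₃≢y₀ (λ eq → c₂≢c₃ (trans c₂≡y₂ (sym eq)))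
          where
          0<3 : i < 3 + i
          0<3 = s≤s (m≤n+m i 2)
          3< : 3 + i < 4 + e + i
          3< = s≤s (s≤s (s≤s (s≤s (m≤n+m i e))))

        -- Now v₁ and v₂ are free, and so is one of vⱼ, vⱼ₊₁ for the triangle x₀ x₂ xⱼ on the
        -- other side of the chord.
        outer : δ (v i) ≡ δ (x i) → δ (v (3 + i)) ≡ δ (x (2 + i)) → ⊥
        outer c₀≡y₀ c₃≡y₂ with chord⇒triangle (s≤s (s≤s (s≤s (s≤s (m≤n+m i e)))))
                                 (+-monoʳ-< (4 + e) {i} {2 + i} (n≤1+n _))
                                 (subst (x (2 + i) ~_) (sym (x-period i)) (~-sym x₀~x₂))
        ... | j , 2<j , j<k , x₂~xⱼ , xⱼ~xₖ with δ (v j) ≟ᶠ δ (x j)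
        -- Here `v j` is free: the path uses the side `x₀xⱼ` and starts from `v₁`.
        ... | no cⱼ≢yⱼ = P₆-from-dominators
          (v≁v 1<j j<k+1) (~-sym (x~v i)) (~-sym (subst (x j ~_) (x-period i) xⱼ~xₖ)) (~-sym (v~x j))
          (x≁v 1<j j<k) (v≁x 1<j j<k-1+1 ∘ ~-sym)
          (dominators-distinct 1<j j<k+1)
          (λ eq → c₀≢c₁ (trans c₀≡y₀ (sym eq))) (dominator-private 1<j j<k-1+1)
          (λ eq → dominators-distinct (<-trans ≤-refl 1<j) j<k (trans c₀≡y₀ (sym eq))) cⱼ≢yⱼ
          where
          1<j : 1 + i < j
          1<j = <-trans ≤-refl 2<j
          j<k-1+1 : j < 3 + e + (1 + i)
          j<k-1+1 = <-≤-trans j<k (s≤s (s≤s (s≤s (+e≤ 1))))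
          j<k+1 : j < 4 + e + (1 + i)
          j<k+1 = m<n⇒m<1+n j<k-1+1
        -- Here the next vertex `v (1 + j)` is free: the path uses the side `x₂xⱼ` and starts from
        -- `v₂`.
        ... | yes cⱼ≡yⱼ = P₆-from-dominators
          (v≁v 2<1+j 1+j<k+2) (v~x (2 + i)) x₂~xⱼ (x~v j)
          (x≁v (s≤s 2<j) 1+j<k+2) (v≁x 2<j j<k-1+2 ∘ ~-sym)
          (dominators-distinct 2<1+j 1+j<k+2)
          (λ eq → c₂≢c₃ (trans eq (sym c₃≡y₂))) (dominator-private 2<j j<k-1+2)
          (λ eq → dominators-distinct (s≤s 2<j) (<-≤-trans 1+j<k+2 (+-monoʳ-≤ (4 + e) (n≤1+n _)))
                    (trans c₃≡y₂ (sym eq)))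
          (λ eq → dominators-distinct ≤-refl (s≤s (s≤s (m≤n+m j (2 + e)))) (trans cⱼ≡yⱼ (sym eq)))
          where
          2<1+j : 2 + i < 1 + j
          2<1+j = m<n⇒m<1+n 2<j
          j<k-1+2 : j < 3 + e + (2 + i)
          j<k-1+2 = <-≤-trans j<k (s≤s (s≤s (s≤s (≤-trans (+e≤ 1) (+-monoʳ-≤ e (n≤1+n _))))))
          1+j<k+2 : 1 + j < 4 + e + (2 + i)
          1+j<k+2 = s≤s j<k-1+2

        absurd : ⊥
        absurd with δ (v (1 + i)) ≟ᶠ δ (x i) | δ (v i) ≟ᶠ δ (x i)
        ... | yes c₁≡y₀ | yes c₀≡y₀ = c₀≢c₁ (trans c₀≡y₀ (sym c₁≡y₀))
        ... | no c₁≢y₀  | yes c₀≡y₀ with δ (v (3 + i)) ≟ᶠ δ (x (2 + i))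
        ...   | yes c₃≡y₂ = outer c₀≡y₀ c₃≡y₂
        ...   | no c₃≢y₂  = c₁∨c₃ c₁≢y₀ c₃≢y₂
        absurd | yes c₁≡y₀ | no c₀≢y₀ with δ (v (2 + i)) ≟ᶠ δ (x (2 + i))
        ...   | yes c₂≡y₂ = inner c₁≡y₀ c₂≡y₂
        ...   | no c₂≢y₂  = c₀∨c₂ c₀≢y₀ c₂≢y₂
        absurd | no c₁≢y₀  | no c₀≢y₀
          with δ (v (3 + i)) ≟ᶠ δ (x (2 + i)) | δ (v (2 + i)) ≟ᶠ δ (x (2 + i))
        ...   | yes c₃≡y₂ | yes c₂≡y₂ = c₂≢c₃ (trans c₂≡y₂ (sym c₃≡y₂))
        ...   | no c₃≢y₂  | _         = c₁∨c₃ c₁≢y₀ c₃≢y₂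
        ...   | yes _     | no c₂≢y₂  = c₀∨c₂ c₀≢y₀ c₂≢y₂

  -- Unrolling an induced cycle of the square

  square⇒close : ∀ {p q} → Adj (square G) p q → Close p q
  square⇒close (inj₁ (a ∷ [] , _))     = inj₁ a
  square⇒close (inj₂ (a ∷ b ∷ [] , _)) = inj₂ (_ , a , b)

  close⇒square : ∀ {p q} → p ≢ q → Close p q → Adj (square G) p q
  close⇒square p≢q (inj₁ a) = inj₁ (a ∷ [] , λ { {zero} _ [] → p≢q refl ; {suc _} (s≤s ()) _ })
  close⇒square {p} {q} p≢q (inj₂ (_ , a , b)) with p ~? q
  ... | yes p~q = close⇒square p≢q (inj₁ p~q)
  ... | no p≁q  = inj₂ (a ∷ b ∷ [] ,
    λ { {zero} _ [] → p≢q refl ; {suc zero} _ (c ∷ []) → p≁q c ; {suc (suc _)} (s≤s (s≤s ())) _ })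

  embedding⇒squareCycle : ∀ {e f} → IsInducedEmbedding (C (4 + e)) (square G) f →
    SquareCycle e λ a → f (a mod (4 + e))
  embedding⇒squareCycle {e} {f} embedding = record
    { period   = λ a → cong f (toℕ-injective (trans (toℕ-mod (k + a))
                   (trans (k+-% a) (sym (toℕ-mod a)))))
    ; injective = λ a<b b<k+a eq → mod-distinct a<b b<k+a (IsInducedEmbedding.injective embedding eq)
    ; near     = λ a → square⇒close (to (adj⇔ _ _) (C-step a))
    ; farApart = λ {a} {b} 1+a<b 1+b<k+a close → C-far 1+a<b 1+b<k+a
                   (from (adj⇔ _ _) (close⇒square
                     (λ eq → mod-distinct (<-trans ≤-refl 1+a<b) (<-trans ≤-refl 1+b<k+a)
                               (IsInducedEmbedding.injective embedding eq)) close))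
    }
    where
    k : ℕ
    k = 4 + e

    adj⇔ = IsInducedEmbedding.adj⇔adj embedding

    toℕ-mod : ∀ a → toℕ (a mod k) ≡ a % k
    toℕ-mod a = toℕ-fromℕ< (m%n<n a k)

    k+-% : ∀ a → (k + a) % k ≡ a % k
    k+-% a = trans (cong (_% k) (+-comm k a)) ([m+n]%n≡m%n a k)

    -- With equal remainders the quotients decide: if that of `b` is not larger then `b ≤ a`,
    -- otherwise `k + a ≤ b`.
    residues-distinct : ∀ {a b} → a < b → b < k + a → a % k ≢ b % k
    residues-distinct {a} {b} a<b b<k+a eq with b / k ≤? a / k
    ... | yes q′≤q = <⇒≱ a<b (begin
        b                     ≡⟨ m≡m%n+[m/n]*n b k ⟩
        b % k + (b / k) * k   ≤⟨ +-mono-≤ (≤-reflexive (sym eq)) (*-monoˡ-≤ k q′≤q) ⟩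
        a % k + (a / k) * k   ≡⟨ m≡m%n+[m/n]*n a k ⟨
        a                     ∎)
      where open ≤-Reasoning
    ... | no q′≰q = <⇒≱ b<k+a (begin
        k + a                       ≡⟨ cong (k +_) (m≡m%n+[m/n]*n a k) ⟩
        k + (a % k + (a / k) * k)   ≡⟨ +-assoc k (a % k) _ ⟨
        k + a % k + (a / k) * k     ≡⟨ cong (_+ (a / k) * k) (+-comm k (a % k)) ⟩
        a % k + k + (a / k) * k     ≡⟨ +-assoc (a % k) k _ ⟩
        a % k + suc (a / k) * k     ≤⟨ +-mono-≤ (≤-reflexive eq) (*-monoˡ-≤ k (≰⇒> q′≰q)) ⟩
        b % k + (b / k) * k         ≡⟨ m≡m%n+[m/n]*n b k ⟨
        b                           ∎)
      where open ≤-Reasoning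

    mod-distinct : ∀ {a b} → a < b → b < k + a → a mod k ≢ b mod k
    mod-distinct {a} {b} a<b b<k+a eq = residues-distinct a<b b<k+a
      (trans (sym (toℕ-mod a)) (trans (cong toℕ eq) (toℕ-mod b)))

    suc-% : ∀ a → suc a % k ≡ suc (a % k) % k
    suc-% a = trans (cong (λ z → suc z % k) (m≡m%n+[m/n]*n a k))
                    ([m+kn]%n≡m%n (suc (a % k)) (a / k) k)

    CycleStep : ℕ → ℕ → Set
    CycleStep i j = suc i ≡ j ⊎ (suc i ≡ k × j ≡ 0)

    -- Modulo `k`, the ordinary step and the wrap-around say the same thing.
    step⇒residue : ∀ a b → CycleStep (toℕ (a mod k)) (toℕ (b mod k)) → suc a % k ≡ b % k
    step⇒residue a b step rewrite toℕ-mod a | toℕ-mod b with step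
    ... | inj₁ eq        = trans (suc-% a) (trans (cong (_% k) eq) (m%n%n≡m%n b k))
    ... | inj₂ (eq , z)  = trans (suc-% a) (trans (cong (_% k) eq) (trans (n%n≡0 k) (sym z)))

    C-step : ∀ a → Adj (C k) (a mod k) (suc a mod k)
    C-step a = mod-distinct ≤-refl (s≤s (s≤s (m≤n+m a (2 + e)))) , inj₁ cycleStep
      where
      cycleStep : CycleStep (toℕ (a mod k)) (toℕ (suc a mod k))
      cycleStep rewrite toℕ-mod a | toℕ-mod (suc a) | suc-% a with m≤n⇒m<n∨m≡n (m%n<n a k)
      ... | inj₁ <k = inj₁ (sym (m<n⇒m%n≡m <k))
      ... | inj₂ eq = inj₂ (eq , trans (cong (_% k) eq) (n%n≡0 k))

    C-far : ∀ {a b} → suc a < b → suc b < k + a → ¬ Adj (C k) (a mod k) (b mod k)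
    C-far {a} {b} 1+a<b 1+b<k+a (_ , inj₁ step) = residues-distinct 1+a<b
      (<-trans (n<1+n b) (<-trans 1+b<k+a (+-monoʳ-< k (n<1+n a)))) (step⇒residue a b step)
    -- A step backwards would identify `suc b` with `a`, although it lies strictly between `a` and
    -- `k + a`.
    C-far {a} {b} 1+a<b 1+b<k+a (_ , inj₂ step) = residues-distinct
      (<-trans (<-trans ≤-refl 1+a<b) ≤-refl) 1+b<k+a (sym (step⇒residue b a step))

theorem1 : ∀ {n : ℕ} (G : Graph n) → P 6 -Free G → HHD-Free G → ∃ (EfficientDominating G) → Chordal (square G)
theorem1 G p6 hhd (_ , efficient) (suc (suc (suc (suc e)))) _ (_ , embedding) =
  no-squareCycle G hhd p6 efficient (embedding⇒squareCycle G embedding)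
theorem1 _ _ _ _ 1 (s≤s ()) _
theorem1 _ _ _ _ 2 (s≤s (s≤s ())) _
theorem1 _ _ _ _ 3 (s≤s (s≤s (s≤s ()))) _
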